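{- Let $X$ be a shift space which is eventually dendric with threshold $m$, let $U\subset\mathcal L(X)$ be a finite bifix code which is two-sided $X$-complete, let $\varphi:B\to U$ be a bijection from an alphabet $B$ onto $U$, extended to a morphism $B^*\to A^*$, and let $Y$ be the shift space on $B$ with $\mathcal L(Y)=\varphi^{ -1}(\mathcal L(X))$ (the complete bifix decoding of $X$ with respect to $U$). Then $Y$ is eventually dendric with threshold $m$.
   Context: Let $A$ be a finite alphabet. A shift space on $A$ is a closed subset $X\subset A^{\mathbb Z}$ invariant under the shift ($\sigma(X)=X$). $\mathcal L(X)$ is the set of finite factors (including the empty word) of elements of $X$; $\mathcal L_n(X)$ its words of length $n$; $\mathcal L_{\ge n}(X)=\bigcup_{k\ge n}\mathcal L_k(X)$. For $w\in\mathcal L(X)$: $L_1(w)=\{a\in A: aw\in\mathcal L(X)\}$, $R_1(w)=\{b\in A: wb\in\mathcal L(X)\}$; the extension graph $\mathcal E_1(w)$ is the undirected bipartite graph with vertex set the disjoint union of $L_1(w)$ and $R_1(w)$ and edges the pairs $(a,b)$ with $awb\in\mathcal L(X)$. $X$ is eventually dendric with threshold $m\ge0$ if $\mathcal E_1(w)$ is a tree for all $w\in\mathcal L_{\ge m}(X)$. A prefix (resp. suffix) code is a set of words none of which is a proper prefix (resp. suffix) of another; a bifix code is both. A set $U\subset\mathcal L(X)$ is right (resp. left) $X$-complete if every long enough word of $\mathcal L(X)$ has a prefix (resp. suffix) in $U$, and two-sided $X$-complete if both. (Under these hypotheses $\varphi^{ -1}(\mathcal L(X))$ is factorial and extendable,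 hence the language of a shift space.) -}

module Defs where

open import Data.Nat using (ℕ; _≤_)
open import Data.Integer using (ℤ; +_; ∣_∣) renaming (_+_ to _+ℤ_)
open import Data.Fin using (Fin)
open import Data.List using (List; []; _∷_; _++_; [_]; map; upTo; length; concatMap)
open import Data.List.Relation.Unary.Unique.Propositional using (Unique)
open import Data.List.Membership.Propositional using (_∈_)
open import Data.Product using (Σ; ∃; ∃-syntax; _×_; _,_)
open import Data.Sum using (_⊎_; inj₁; inj₂)
open import Data.Empty using (⊥)
open import Data.Unit using (⊤)
open import Relation.Nullary using (¬_)
open import Relation.Binary.PropositionalEquality using (_≡_; _≢_)
open import Function.Bundles using (_↔_)
open import Function.Definitions using (Injective)

Finite : Set → Set
Finite A = ∃[ n ] (A ↔ Fin n)

Config : Set → Set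
Config A = ℤ → A

σ : {A : Set} → Config A → Config A
σ x i = x (i +ℤ + 1)

window : {A : Set} → Config A → ℤ → ℕ → List A
window x i n = map (λ k → x (i +ℤ + k)) (upTo n)

record ShiftSpace (A : Set) : Set₁ where
  field
    pts       : Config A → Set
    -- closed in the product topology: x is in X as soon as every central
    -- window x[-n..n] is the central window of some point of X
    closed    : ∀ x → (∀ n → ∃[ y ] (pts y × (∀ i → ∣ i ∣ ≤ n → y i ≡ x i))) → pts x
    shift-⊆   : ∀ x → pts x → pts (σ x)
    shift-⊇   : ∀ x → pts x → ∃[ y ] (pts y × (∀ i → σ y i ≡ x i))
open ShiftSpace public

𝓛 : {A : Set} → ShiftSpace A → List A → Set
𝓛 X w = ∃[ x ] (pts X x × ∃[ i ] (window x i (length w) ≡ w))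

record Graph (V : Set) : Set₁ where
  field
    Vert : V → Set
    Adj  : V → V → Set
open Graph public

data Walk {V : Set} (G : Graph V) : V → V → Set where
  stop : ∀ {v} → Walk G v v
  step : ∀ {u v w} → Adj G u v → Walk G v w → Walk G u w

Chain : {V : Set} → Graph V → List V → Set
Chain G []           = ⊤
Chain G (x ∷ [])     = ⊤
Chain G (x ∷ y ∷ vs) = Adj G x y × Chain G (y ∷ vs)

IsCycle : {V : Set} → Graph V → List V → Set
IsCycle G []       = ⊥
IsCycle G (v ∷ vs) = 3 ≤ length (v ∷ vs) × Unique (v ∷ vs) × Chain G ((v ∷ vs) ++ [ v ])

Connected : {V : Set} → Graph V → Set
Connected G = ∀ u v → Vert G u → Vert G v → Walk G u v

Acyclic : {V : Set} → Graph V → Set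
Acyclic G = ¬ (∃[ vs ] IsCycle G vs)

IsTree : {V : Set} → Graph V → Set
IsTree G = (∃[ v ] Vert G v) × Connected G × Acyclic G

L₁ : {A : Set} → ShiftSpace A → List A → A → Set
L₁ X w a = 𝓛 X (a ∷ w)

R₁ : {A : Set} → ShiftSpace A → List A → A → Set
R₁ X w b = 𝓛 X (w ++ [ b ])

extAdj : {A : Set} → ShiftSpace A → List A → A ⊎ A → A ⊎ A → Set
extAdj X w (inj₁ a) (inj₂ b) = 𝓛 X (a ∷ w ++ [ b ])
extAdj X w (inj₂ b) (inj₁ a) = 𝓛 X (a ∷ w ++ [ b ])
extAdj X w (inj₁ _) (inj₁ _) = ⊥
extAdj X w (inj₂ _) (inj₂ _) = ⊥

extVert : {A : Set} → ShiftSpace A → List A → A ⊎ A → Set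
extVert X w (inj₁ a) = L₁ X w a
extVert X w (inj₂ b) = R₁ X w b

𝓔₁ : {A : Set} → ShiftSpace A → List A → Graph (A ⊎ A)
𝓔₁ X w = record { Vert = extVert X w ; Adj = extAdj X w }

EventuallyDendric : {A : Set} → ShiftSpace A → ℕ → Set
EventuallyDendric X m = ∀ w → 𝓛 X w → m ≤ length w → IsTree (𝓔₁ X w)

IsPrefixCode : {A : Set} → (List A → Set) → Set
IsPrefixCode {A} U = ∀ u v → U u → U v → (s : List A) → s ≢ [] → u ++ s ≢ v

IsSuffixCode : {A : Set} → (List A → Set) → Set
IsSuffixCode {A} U = ∀ u v → U u → U v → (s : List A) → s ≢ [] → s ++ u ≢ v

IsBifixCode : {A : Set} → (List A → Set) → Set
IsBifixCode U = IsPrefixCode U × IsSuffixCode U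

FiniteSet : {A : Set} → (List A → Set) → Set
FiniteSet {A} U = ∃[ l ] (∀ u → U u → u ∈ l)

RightComplete : {A : Set} → ShiftSpace A → (List A → Set) → Set
RightComplete X U = ∃[ N ] (∀ w → 𝓛 X w → N ≤ length w → ∃[ u ] (U u × ∃[ s ] (u ++ s ≡ w)))

LeftComplete : {A : Set} → ShiftSpace A → (List A → Set) → Set
LeftComplete X U = ∃[ N ] (∀ w → 𝓛 X w → N ≤ length w → ∃[ u ] (U u × ∃[ s ] (s ++ u ≡ w)))

TwoSidedComplete : {A : Set} → ShiftSpace A → (List A → Set) → Set
TwoSidedComplete X U = RightComplete X U × LeftComplete X U

ext : {A B : Set} → (B → List A) → List B → List A
ext φ = concatMap φ

IsBijectionOnto : {A B : Set} → (B → List A) → (List A → Set) → Set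
IsBijectionOnto φ U = Injective _≡_ _≡_ φ × (∀ b → U (φ b)) × (∀ u → U u → ∃[ b ] (φ b ≡ u))

{-# OPTIONS --safe #-}
-- If the empty word is in U, then B is a single letter.  Otherwise v = φ(w) is at
-- least as long as w, and the graph extending v by codewords on both sides is built
-- from the trees 𝓔₁(p v q) in two stages: first left letters are replaced by left
-- codewords (keeping letters on the right), then right letters by right codewords.
-- In each stage the graph restricted to the codewords ending with p is obtained by
-- gluing the graphs for a p onto the tree at p in place of the vertices a, which
-- preserves connectedness and acyclicity.
--
-- Acyclicity is used in the form "every edge is a bridge", witnessed by a predicate
-- on vertices which only that edge changes; this needs no decidability of 𝓛(X).
-- Connectedness is used in the form "any two vertices on one side are joined by a
-- sequence of common neighbours".
module Submission where

open import Defs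
open import Data.Nat using (ℕ; zero; suc; _+_; _≤_; z≤n; s≤s)
open import Data.Nat.Properties using (≤-trans; ≤-reflexive; +-suc; +-identityʳ; m≤m+n)
open import Data.Integer using (ℤ; +_; -[1+_]) renaming (_+_ to _+ℤ_)
import Data.Integer.Properties as ℤ
open import Data.Fin.Properties using (inj⇒≟)
open import Data.List using (List; []; _∷_; _++_; _∷ʳ_; _ʳ++_; [_]; map; upTo; applyUpTo; length; reverse)
open import Data.List.Properties using (map-∘; map-cong; map-++; map-upTo; upTo-∷ʳ; ∷-injectiveʳ; ∷ʳ-injectiveˡ; ∷ʳ-injectiveʳ; ++-assoc; ++-identityʳ; ++-cancelʳ; ʳ++-defn; unfold-reverse; reverse-++; reverse-involutive; reverse-injective; length-++; length-++-≤ˡ; length-++-≤ʳ; length-reverse; concatMap-++) renaming (≡-dec to List-≡-dec)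
open import Data.List.Relation.Unary.All using (All; []; _∷_)
open import Data.List.Relation.Unary.AllPairs using ([]; _∷_)
open import Data.List.Relation.Unary.Any using (here; there)
open import Data.List.Relation.Unary.All.Properties using (¬Any⇒All¬)
open import Data.List.Relation.Unary.Unique.Propositional using (Unique)
open import Data.List.Membership.Propositional using (_∈_)
open import Data.List.Membership.DecPropositional using (_∈?_)
open import Data.Product using (_×_; _,_; proj₁; proj₂; ∃-syntax)
open import Data.Sum using (_⊎_; inj₁; inj₂; swap)
open import Data.Sum.Properties using (≡-dec; inj₁-injective; inj₂-injective)
open import Data.Empty using (⊥; ⊥-elim)
open import Data.Unit using (⊤; tt)
open import Function using (_∘_; _∘′_; flip; id)
open import Function.Bundles using (_⇔_; mk⇔; Equivalence)
open import Function.Construct.Symmetry using (⇔-sym)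
open import Function.Construct.Composition using (_⇔-∘_)
open import Function.Properties.Inverse using (↔⇒↣)
open import Relation.Binary using (DecidableEquality)
open import Relation.Binary.Construct.Closure.ReflexiveTransitive using (Star; ε; _◅_; kleisliStar)
open import Relation.Binary.PropositionalEquality using (_≡_; _≢_; refl; sym; trans; cong; subst; module ≡-Reasoning)
open import Relation.Nullary using (¬_; yes; no)
open import Relation.Nullary.Decidable using (map′)

open Equivalence using (to; from)

-- The language of a shift space

module _ {A : Set} where

  window-suc : ∀ (x : Config A) i n → window x i (suc n) ≡ x (i +ℤ + 0) ∷ window x (i +ℤ + 1) n
  window-suc x i n = cong (x (i +ℤ + 0) ∷_) (begin
    map (λ k → x (i +ℤ + k)) (applyUpTo suc n)  ≡⟨ cong (map _) (map-upTo suc n) ⟨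
    map (λ k → x (i +ℤ + k)) (map suc (upTo n))           ≡⟨ map-∘ (upTo n) ⟨
    map (λ k → x (i +ℤ + suc k)) (upTo n)                 ≡⟨ map-cong (λ k → cong x (sym (ℤ.+-assoc i (+ 1) (+ k)))) (upTo n) ⟩
    window x (i +ℤ + 1) n                                 ∎)
    where open ≡-Reasoning

  window-∷ʳ : ∀ (x : Config A) i n → window x i (suc n) ≡ window x i n ∷ʳ x (i +ℤ + n)
  window-∷ʳ x i n = trans (cong (map _) (sym (upTo-∷ʳ n))) (map-++ _ (upTo n) [ n ])

  length-∷ʳ : ∀ (w : List A) {b} → length (w ∷ʳ b) ≡ suc (length w)
  length-∷ʳ w = trans (length-++ w) (trans (+-suc (length w) 0) (cong suc (+-identityʳ (length w))))

module _ {A : Set} (X : ShiftSpace A) where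

  𝓛-tail : ∀ {a w} → 𝓛 X (a ∷ w) → 𝓛 X w
  𝓛-tail {w = w} (x , x∈X , i , eq) =
    x , x∈X , i +ℤ + 1 , ∷-injectiveʳ (trans (sym (window-suc x i (length w))) eq)

  𝓛-init : ∀ w {b} → 𝓛 X (w ∷ʳ b) → 𝓛 X w
  𝓛-init w (x , x∈X , i , eq) = x , x∈X , i , ∷ʳ-injectiveˡ _ w
    (trans (sym (window-∷ʳ x i (length w))) (trans (cong (window x i) (sym (length-∷ʳ w))) eq))

  𝓛-suffix : ∀ u {w} → 𝓛 X (u ++ w) → 𝓛 X w
  𝓛-suffix []      l = l
  𝓛-suffix (_ ∷ u) l = 𝓛-suffix u (𝓛-tail l)

  𝓛-prefix : ∀ u w → 𝓛 X (u ++ w) → 𝓛 X u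
  𝓛-prefix u []      l = subst (𝓛 X) (++-identityʳ u) l
  𝓛-prefix u (c ∷ w) l = 𝓛-init u (𝓛-prefix (u ∷ʳ c) w (subst (𝓛 X) (sym (++-assoc u [ c ] w)) l))

  𝓛-extendˡ : ∀ {w} → 𝓛 X w → ∃[ a ] 𝓛 X (a ∷ w)
  𝓛-extendˡ {w} (x , x∈X , i , eq) = _ , x , x∈X , j ,
    trans (window-suc x j (length w)) (cong (x (j +ℤ + 0) ∷_) (trans (cong (λ h → window x h (length w)) j+1≡i) eq))
    where
    j : ℤ
    j = i +ℤ -[1+ 0 ]
    j+1≡i : j +ℤ + 1 ≡ i
    j+1≡i = trans (ℤ.+-assoc i -[1+ 0 ] (+ 1)) (ℤ.+-identityʳ i)

  𝓛-extendʳ : ∀ w → 𝓛 X w → ∃[ b ] 𝓛 X (w ∷ʳ b)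
  𝓛-extendʳ w (x , x∈X , i , eq) = _ , x , x∈X , i ,
    trans (cong (window x i) (length-∷ʳ w)) (trans (window-∷ʳ x i (length w)) (cong (_∷ʳ x (i +ℤ + length w)) eq))

-- Simple paths and cycles

module _ {V : Set} where

  -- Indexed by the full list of vertices, so that closing a path up yields a `Chain` in the form
  -- that `IsCycle` asks for.
  data PathTo (G : Graph V) (t : V) : List V → Set where
    end : PathTo G t [ t ]
    _▸_ : ∀ {u v vs} → Adj G u v → PathTo G t (v ∷ vs) → PathTo G t (u ∷ v ∷ vs)

  PathTo-map : ∀ {G H t vs} → (∀ {u v} → Adj G u v → Adj H u v) → PathTo G t vs → PathTo H t vs
  PathTo-map f end     = end
  PathTo-map f (e ▸ p) = f e ▸ PathTo-map f p

  PathTo-close : ∀ {G t z vs} → PathTo G t vs → Adj G t z → Chain G (vs ++ [ z ])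
  PathTo-close end           e′ = e′ , tt
  PathTo-close (e ▸ end)     e′ = e , e′ , tt
  PathTo-close (e ▸ (f ▸ p)) e′ = e , PathTo-close (f ▸ p) e′

  SimplePath : Graph V → V → V → Set
  SimplePath G u t = ∃[ vs ] (Unique (u ∷ vs) × PathTo G t (u ∷ vs))

  restart : ∀ {G t u vs} → u ∈ vs → Unique vs → PathTo G t vs → SimplePath G u t
  restart (here refl) uniq      p       = _ , uniq , p
  restart (there u∈)  (_ ∷ uniq) (_ ▸ p) = restart u∈ uniq p

  loop-erase : ∀ {G u t} → DecidableEquality V → Walk G u t → SimplePath G u t
  loop-erase _≟_ stop = [] , [] ∷ [] , end
  loop-erase {u = u} _≟_ (step {v = v} e w) with loop-erase _≟_ w
  ... | vs , uniq , p with _∈?_ _≟_ u (v ∷ vs)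
  ...   | yes u∈ = restart u∈ uniq p
  ...   | no  u∉ = v ∷ vs , ¬Any⇒All¬ _ u∉ ∷ uniq , e ▸ p

  remove : Graph V → V → V → Graph V
  remove G u v = record
    { Vert = Vert G
    ; Adj  = λ x y → Adj G x y × ¬ (x ≡ u × y ≡ v) × ¬ (x ≡ v × y ≡ u)
    }

  -- A walk that avoids the edge becomes a simple path by loop erasure, and the edge would close
  -- this path to a cycle.
  acyclic⇒bridge : ∀ {G u v} → DecidableEquality V → Acyclic G → u ≢ v → Adj G v u →
                   ¬ Walk (remove G u v) u v
  acyclic⇒bridge _≟_ acyc u≢v e w with loop-erase _≟_ w
  ... | []         , _    , end           = u≢v refl
  -- A path with a single edge would consist of the deleted edge.
  ... | _ ∷ []     , _    , (e′ ▸ end)    = proj₁ (proj₂ e′) (refl , refl)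
  ... | _ ∷ _ ∷ _  , uniq , p             =
    acyc (_ , s≤s (s≤s (s≤s z≤n)) , uniq , PathTo-close (PathTo-map proj₁ p) e)

-- Bipartite forests

record Cut {L R : Set} (E : L → R → Set) (l : L) (r : R) : Set₁ where
  field
    side  : L ⊎ R → Set
    near  : side (inj₁ l)
    far   : ¬ side (inj₂ r)
    along : ∀ {x y} → E x y → ¬ (x ≡ l × y ≡ r) → side (inj₁ x) ⇔ side (inj₂ y)

Forest : {L R : Set} → (L → R → Set) → Set₁
Forest E = ∀ {l r} → E l r → Cut E l r

¬-cong-⇔ : {P Q : Set} → P ⇔ Q → (¬ P) ⇔ (¬ Q)
¬-cong-⇔ eq = mk⇔ (_∘′ from eq) (_∘′ to eq)

-- The complement of `side` is the new side, since `near` must now hold at the other end; only the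
-- double negation of `near` is needed for `far`.
Forest-flip : ∀ {L R : Set} {E : L → R → Set} → Forest E → Forest (flip E)
Forest-flip forest e = record
  { side  = λ z → ¬ side (swap z)
  ; near  = far
  ; far   = λ ¬near → ¬near near
  ; along = λ e′ other → ⇔-sym (¬-cong-⇔ (along e′ λ (p , q) → other (q , p)))
  }
  where open Cut (forest e)

Forest-map : ∀ {L R : Set} {E E′ : L → R → Set} → (∀ {l r} → E l r ⇔ E′ l r) → Forest E → Forest E′
Forest-map eq forest e = record
  { side = side ; near = near ; far = far ; along = along ∘′ from eq }
  where open Cut (forest (from eq e))

singleton⇒forest : ∀ {B : Set} {E : B → B → Set} → (∀ x y → x ≡ y) → Forest E
singleton⇒forest all-≡ _ = record
  { side  = λ { (inj₁ _) → ⊤ ; (inj₂ _) → ⊥ }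
  ; near  = tt
  ; far   = id
  ; along = λ _ other → ⊥-elim (other (all-≡ _ _ , all-≡ _ _))
  }

module _ {A : Set} (X : ShiftSpace A) (w : List A) where

  Edge : A → A → Set
  Edge a b = 𝓛 X (a ∷ w ++ [ b ])

  extAdj-sym : ∀ u v → extAdj X w u v → extAdj X w v u
  extAdj-sym (inj₁ _) (inj₂ _) e = e
  extAdj-sym (inj₂ _) (inj₁ _) e = e

  -- The side of `a` consists of the vertices that still reach `a` after the edge is deleted; `b` is
  -- not among them because the edge is a bridge.
  acyclic⇒forest : DecidableEquality A → Acyclic (𝓔₁ X w) → Forest Edge
  acyclic⇒forest _≟_ acyc {a} {b} e = record
    { side  = λ z → Walk G z (inj₁ a)
    ; near  = stop
    ; far   = acyclic⇒bridge (≡-dec _≟_ _≟_) acyc (λ ()) e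
    ; along = λ e′ other → mk⇔
        (step (e′ , (λ (p , q) → other (inj₁-injective q , inj₂-injective p)) , λ ()))
        (step (e′ , (λ ()) , λ (p , q) → other (inj₁-injective p , inj₂-injective q)))
    }
    where
    G : Graph (A ⊎ A)
    G = remove (𝓔₁ X w) (inj₂ b) (inj₁ a)

  module _ (S : A ⊎ A → Set) (u v : A ⊎ A)
           (along : ∀ x y → extAdj X w x y → u ≢ x → v ≢ x → S x ⇔ S y) where

    chain-along : ∀ y ys → All (u ≢_) (y ∷ ys) → All (v ≢_) (y ∷ ys) →
                  Chain (𝓔₁ X w) (y ∷ ys ++ [ u ]) → S y ⇔ S u
    chain-along y []       (u≢ ∷ _)  (v≢ ∷ _)  (e , _) = along y u e u≢ v≢
    chain-along y (z ∷ ys) (u≢ ∷ us) (v≢ ∷ vs) (e , c) =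
      chain-along z ys us vs c ⇔-∘ along y z e u≢ v≢

    -- Go from `u` to `v` the long way round: every edge used can be read as starting outside `u`
    -- and `v`, the edge between `v` and `y` being read from `y`.
    cycle-along : ∀ ys → IsCycle (𝓔₁ X w) (u ∷ v ∷ ys) → S u ⇔ S v
    cycle-along [] (s≤s (s≤s ()) , _)
    cycle-along (y ∷ ys) (_ , (_ ∷ u≢y ∷ us) ∷ (v≢y ∷ vs) ∷ _ , _ , e , c) =
      along y v (extAdj-sym v y e) u≢y v≢y ⇔-∘ ⇔-sym (chain-along y ys (u≢y ∷ us) (v≢y ∷ vs) c)

  -- Cut at the first edge of the cycle: the rest of the cycle carries `side` from the near end to
  -- the far end.
  forest⇒acyclic : Forest Edge → Acyclic (𝓔₁ X w)
  forest⇒acyclic forest (u ∷ [] , s≤s () , _)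
  forest⇒acyclic forest (inj₁ a ∷ inj₁ b ∷ vs , _ , _ , () , _)
  forest⇒acyclic forest (inj₂ a ∷ inj₂ b ∷ vs , _ , _ , () , _)
  forest⇒acyclic forest (inj₁ a ∷ inj₂ b ∷ vs , cyc@(_ , _ , e , _)) =
    far (to (cycle-along side (inj₁ a) (inj₂ b) along′ vs cyc) near)
    where
    open Cut (forest e)
    along′ : ∀ x y → extAdj X w x y → inj₁ a ≢ x → inj₂ b ≢ x → side x ⇔ side y
    along′ (inj₁ x) (inj₂ y) e a≢ b≢ = along e λ (p , _) → a≢ (cong inj₁ (sym p))
    along′ (inj₂ y) (inj₁ x) e a≢ b≢ = ⇔-sym (along e λ (_ , q) → b≢ (cong inj₂ (sym q)))
  forest⇒acyclic forest (inj₂ b ∷ inj₁ a ∷ vs , cyc@(_ , _ , e , _)) =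
    far (from (cycle-along side (inj₂ b) (inj₁ a) along′ vs cyc) near)
    where
    open Cut (forest e)
    along′ : ∀ x y → extAdj X w x y → inj₂ b ≢ x → inj₁ a ≢ x → side x ⇔ side y
    along′ (inj₁ x) (inj₂ y) e b≢ a≢ = along e λ (p , _) → a≢ (cong inj₁ (sym p))
    along′ (inj₂ y) (inj₁ x) e b≢ a≢ = ⇔-sym (along e λ (_ , q) → b≢ (cong inj₂ (sym q)))

-- Sequences of common neighbours

Link : {L R : Set} → (L → R → Set) → R → R → Set
Link E r r′ = ∃[ l ] (E l r × E l r′)

Linked : {L R : Set} → (L → R → Set) → R → R → Set
Linked E = Star (Link E)

-- Shifts the sequence by half a step: its right vertices become the common neighbours of
-- consecutive left vertices.
Linked-flip : ∀ {L R : Set} {E : L → R → Set} {l l′ r r′} →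
              E l r → Linked E r r′ → E l′ r′ → Linked (flip E) l l′
Linked-flip e ε                  e′ = (_ , e , e′) ◅ ε
Linked-flip e ((_ , f , g) ◅ fs) e′ = (_ , e , f) ◅ Linked-flip g fs e′

Linked-map : ∀ {L R : Set} {E E′ : L → R → Set} → (∀ {l r} → E l r → E′ l r) →
             ∀ {r r′} → Linked E r r′ → Linked E′ r r′
Linked-map f = kleisliStar id λ (l , e , e′) → (l , f e , f e′) ◅ ε

module _ {A : Set} (X : ShiftSpace A) (w : List A) where

  walk⇒linked : ∀ {b b′} → Walk (𝓔₁ X w) (inj₂ b) (inj₂ b′) → Linked (Edge X w) b b′
  walk⇒linked stop = ε
  walk⇒linked (step {v = inj₁ a} e (step {v = inj₂ _} f p)) = (a , e , f) ◅ walk⇒linked p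

  linked⇒walk : ∀ {a a′} → Linked (flip (Edge X w)) a a′ → ∀ {v} →
                Walk (𝓔₁ X w) (inj₁ a′) v → Walk (𝓔₁ X w) (inj₁ a) v
  linked⇒walk ε                  p = p
  linked⇒walk ((b , e , f) ◅ fs) p = step {v = inj₂ b} e (step f (linked⇒walk fs p))

  -- Left vertices suffice, since every right vertex has a left neighbour by extendability of the
  -- language.
  linked⇒connected : (∀ {a a′} → L₁ X w a → L₁ X w a′ → Linked (flip (Edge X w)) a a′) →
                     Connected (𝓔₁ X w)
  linked⇒connected linked (inj₁ a) (inj₁ a′) l l′ = linked⇒walk (linked l l′) stop
  linked⇒connected linked (inj₁ a) (inj₂ b)  l r with 𝓛-extendˡ X r
  ... | a′ , e = linked⇒walk (linked l (𝓛-init X (a′ ∷ w) e)) (step e stop)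
  linked⇒connected linked (inj₂ b) v r l with 𝓛-extendˡ X r
  linked⇒connected linked (inj₂ b) (inj₁ a) r l | a′ , e =
    step {v = inj₁ a′} e (linked⇒walk (linked (𝓛-init X (a′ ∷ w) e) l) stop)
  linked⇒connected linked (inj₂ b) (inj₂ b′) r r′ | a , e with 𝓛-extendˡ X r′
  ... | a′ , e′ = step {v = inj₁ a} e
    (linked⇒walk (linked (𝓛-init X (a ∷ w) e) (𝓛-init X (a′ ∷ w) e′)) (step e′ stop))

-- Replacing letters by codewords on one side

-- The letter just before the suffix `p` is determined by the word, so a codeword ending properly
-- with `p` lies above only one vertex of the tree at `p`.
ʳ++-∷-injective : ∀ {A : Set} (s s′ : List A) {a a′} p → s ʳ++ (a ∷ p) ≡ s′ ʳ++ (a′ ∷ p) → a ≡ a′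
ʳ++-∷-injective s s′ {a} {a′} p eq = ∷ʳ-injectiveʳ (reverse s) (reverse s′)
  (++-cancelʳ p _ _ (begin
    (reverse s ∷ʳ a) ++ p    ≡⟨ ++-assoc (reverse s) [ a ] p ⟩
    reverse s ++ a ∷ p       ≡⟨ ʳ++-defn s ⟨
    s ʳ++ (a ∷ p)            ≡⟨ eq ⟩
    s′ ʳ++ (a′ ∷ p)          ≡⟨ ʳ++-defn s′ ⟩
    reverse s′ ++ a′ ∷ p     ≡⟨ ++-assoc (reverse s′) [ a′ ] p ⟨
    (reverse s′ ∷ʳ a′) ++ p  ∎))
  where open ≡-Reasoning

-- F p r says that the word p and the vertex r on the other side are
-- compatible; words grow at the head.
module Substitution {A B R : Set} (F : List A → R → Set)
  (F-tail : ∀ {a p r} → F (a ∷ p) r → F p r) (C : B → List A) where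

  F-suffix : ∀ s {p r} → F (s ++ p) r → F p r
  F-suffix []      f = f
  F-suffix (_ ∷ s) f = F-suffix s (F-tail f)

  F-suffixʳ : ∀ s {p r} → F (s ʳ++ p) r → F p r
  F-suffixʳ s f = F-suffix (reverse s) (subst (λ q → F q _) (ʳ++-defn s) f)

  module _ (linked : ∀ p {r r′} → F p r → F p r′ → Linked (λ a → F (a ∷ p)) r r′)
           (N : ℕ) (complete : ∀ p {r} → F p r → N ≤ length p → ∃[ x ] ∃[ s ] (s ++ C x ≡ p)) where

    -- Induction on `k`, a bound on the letters missing before completeness applies. A long `p` ends
    -- with a codeword, which is a common neighbour; otherwise each link through a letter `a` is
    -- refined by the case of `a ∷ p`.
    substitute-linked-≤ : ∀ k p {r r′} → N ≤ k + length p → F p r → F p r′ →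
                          Linked (λ x → F (C x)) r r′
    substitute-linked-≤ zero p N≤ f f′ with complete p f N≤
    ... | x , s , refl = (x , F-suffix s f , F-suffix s f′) ◅ ε
    substitute-linked-≤ (suc k) p N≤ f f′ =
      kleisliStar id
        (λ (a , g , g′) → substitute-linked-≤ k (a ∷ p) (≤-trans N≤ (≤-reflexive (sym (+-suc k (length p))))) g g′)
        (linked p f f′)

    substitute-linked : ∀ {r r′} → F [] r → F [] r′ → Linked (λ x → F (C x)) r r′
    substitute-linked = substitute-linked-≤ N [] (m≤m+n N 0)

  module _ (_≟_ : DecidableEquality A) (_≟ᴿ_ : DecidableEquality R)
           (code : ∀ {x y} s → C x ≡ s ++ C y → s ≡ [] × x ≡ y)
           (forest : ∀ p → Forest (λ a → F (a ∷ p))) where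

    -- The cofactor s is stored reversed, so that (a ∷ s) ʳ++ p reduces to s ʳ++ (a ∷ p).
    EndsWith : List A → B → Set
    EndsWith p x = ∃[ s ] (C x ≡ s ʳ++ p)

    EdgeAbove : List A → B → R → Set
    EdgeAbove p x r = EndsWith p x × F (C x) r

    above-head : ∀ s {a p x r} → C x ≡ s ʳ++ (a ∷ p) → F (C x) r → F (a ∷ p) r
    above-head s eq f = F-suffixʳ s (subst (λ q → F q _) eq f)

    codeword-not-above : ∀ s {a p x y} → C x ≡ p → C y ≢ s ʳ++ (a ∷ p)
    codeword-not-above s {a} refl eq
      with reverse-injective {x = a ∷ s} {y = []} (proj₁ (code (reverse (a ∷ s)) (trans eq (ʳ++-defn (a ∷ s)))))
    ... | ()

    -- An edge at u lies above the vertex a of the tree at p.  A cut of the part above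
    -- a ∷ p extends to the part above p: deleting a from the tree leaves
    -- branches, one for each neighbour b₁ of a, and each branch goes to the side of b₁.
    module Glue {p a u r} s (u-above : C u ≡ s ʳ++ (a ∷ p)) (f : F (C u) r)
                (cut : Cut (EdgeAbove (a ∷ p)) u r) where
      open Cut

      -- The branch of `b₁` is the far side of the edge from `a` to `b₁`, hence the negation; it is
      -- selected when its root `b₁` is on the side of `cut`.
      InBranch : A ⊎ R → Set
      InBranch z = ∃[ b₁ ] ∃[ e ] (side cut (inj₂ b₁) × ¬ side (forest p {a} {b₁} e) z)

      -- An edge that avoids `a` differs from every edge between `a` and a root `b₁`, so it crosses
      -- none of these cuts.
      InBranch-along : ∀ {a′ c} → F (a′ ∷ p) c → a′ ≢ a → InBranch (inj₁ a′) ⇔ InBranch (inj₂ c)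
      InBranch-along e a′≢a = mk⇔
        (λ (b₁ , e₁ , s₁ , n) → b₁ , e₁ , s₁ , to (¬-cong-⇔ (along (forest p e₁) e (a′≢a ∘ proj₁))) n)
        (λ (b₁ , e₁ , s₁ , n) → b₁ , e₁ , s₁ , from (¬-cong-⇔ (along (forest p e₁) e (a′≢a ∘ proj₁))) n)

      -- A neighbour `c` of `a` lies in no branch but its own: for `b₁` other than `c`, the edge
      -- from `a` to `c` keeps `c` on the side of `a`.
      branch-root : ∀ {c} → F (a ∷ p) c → InBranch (inj₂ c) ⇔ side cut (inj₂ c)
      branch-root {c} e = mk⇔ root (λ s₁ → c , e , s₁ , far (forest p e))
        where
        root : InBranch (inj₂ c) → side cut (inj₂ c)
        root (b₁ , e₁ , s₁ , n) with c ≟ᴿ b₁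
        ... | yes refl = s₁
        ... | no  c≢b₁ = ⊥-elim (n (to (along (forest p e₁) e (c≢b₁ ∘ proj₂)) (near (forest p e₁))))

      -- Codewords above `a` keep their side in `cut`; those above another letter `a′` inherit the
      -- branch of `a′`.
      glued : B ⊎ R → Set
      glued (inj₁ x) = ∃[ a′ ] (EndsWith (a′ ∷ p) x ×
                                ((a′ ≡ a × side cut (inj₁ x)) ⊎ (a′ ≢ a × InBranch (inj₁ a′))))
      glued (inj₂ c) = InBranch (inj₂ c)

      glued-at : ∀ {x} → EndsWith (a ∷ p) x → glued (inj₁ x) ⇔ side cut (inj₁ x)
      glued-at {x} x-above@(t , eq) = mk⇔ at (λ s₁ → a , x-above , inj₁ (refl , s₁))
        where
        at : glued (inj₁ x) → side cut (inj₁ x)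
        at (_ , _          , inj₁ (_ , s₁))   = s₁
        at (_ , (t′ , eq′) , inj₂ (a′≢a , _)) = ⊥-elim (a′≢a (ʳ++-∷-injective t′ t p (trans (sym eq′) eq)))

      glued-off : ∀ {a′ x} → EndsWith (a′ ∷ p) x → a′ ≢ a → glued (inj₁ x) ⇔ InBranch (inj₁ a′)
      glued-off {a′} {x} x-above@(t , eq) a′≢a = mk⇔ off (λ i → a′ , x-above , inj₂ (a′≢a , i))
        where
        off : glued (inj₁ x) → InBranch (inj₁ a′)
        off (_ , (t′ , eq′) , c) with ʳ++-∷-injective t t′ p (trans (sym eq) eq′)
        off (_ , _ , inj₁ (a′≡a , _)) | refl = ⊥-elim (a′≢a a′≡a)
        off (_ , _ , inj₂ (_ , i))    | refl = i

      glued-along : ∀ {x c} → EdgeAbove p x c → ¬ (x ≡ u × c ≡ r) → glued (inj₁ x) ⇔ glued (inj₂ c)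
      -- Here `p` itself would be a codeword and a proper suffix of `C u`.
      glued-along (([] , eq) , _) _ = ⊥-elim (codeword-not-above s eq u-above)
      glued-along ((a′ ∷ t , eq) , g) other with a′ ≟ a
      ... | yes refl = ⇔-sym (branch-root (above-head t eq g)) ⇔-∘
                       (along cut ((t , eq) , g) other ⇔-∘ glued-at (t , eq))
      ... | no a′≢a  = InBranch-along (above-head t eq g) a′≢a ⇔-∘ glued-off (t , eq) a′≢a

      glue : Cut (EdgeAbove p) u r
      glue = record
        { side  = glued
        ; near  = from (glued-at (s , u-above)) (near cut)
        ; far   = far cut ∘ to (branch-root (above-head s u-above f))
        ; along = glued-along
        }

    -- The recursion moves letters from `s` to `p` until `p` is all of `C u`, then glues on the way
    -- back.
    cut-above : ∀ s p {u r} → C u ≡ s ʳ++ p → F (C u) r → Cut (EdgeAbove p) u r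
    cut-above (a ∷ s) p eq f = Glue.glue s eq f (cut-above s (a ∷ p) eq f)
    -- Only `u` ends with `C u`, so this part is a star centred at `u`, from which the leaf `r` is
    -- cut off.
    cut-above [] p {u} {r} refl f = record
      { side  = λ { (inj₁ _) → ⊤ ; (inj₂ c) → c ≢ r }
      ; near  = tt
      ; far   = λ r≢r → r≢r refl
      ; along = λ ((t , eq) , _) other → mk⇔
          (λ _ c≡r → other (proj₂ (code (reverse t) (trans eq (ʳ++-defn t))) , c≡r))
          (λ _ → tt)
      }

    substitute-forest : Forest (λ x → F (C x))
    substitute-forest {u} f = record
      { side = side ; near = near ; far = far ; along = λ {x} → along ∘′ (ends-with-[] x ,_) }
      where
      ends-with-[] : ∀ x → EndsWith [] x
      ends-with-[] x = reverse (C x) , sym (reverse-involutive (C x))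
      open Cut (cut-above (reverse (C u)) [] (proj₂ (ends-with-[] u)) f)

-- Extending a long word by codewords on both sides

module _ {A B : Set} (X : ShiftSpace A) (m : ℕ) (dendric : EventuallyDendric X m)
  (_≟_ : DecidableEquality A) (φ : B → List A)
  (prefix-free : ∀ {x y} s → φ x ≡ φ y ++ s → s ≡ [] × x ≡ y)
  (suffix-free : ∀ {x y} s → φ x ≡ s ++ φ y → s ≡ [] × x ≡ y)
  (Nʳ : ℕ) (completeʳ : ∀ w → 𝓛 X w → Nʳ ≤ length w → ∃[ x ] ∃[ s ] (φ x ++ s ≡ w))
  (Nˡ : ℕ) (completeˡ : ∀ w → 𝓛 X w → Nˡ ≤ length w → ∃[ x ] ∃[ s ] (s ++ φ x ≡ w))
  where

  module LeftExtension (v : List A) (m≤v : m ≤ length v) where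

    F : List A → A → Set
    F p b = 𝓛 X (p ++ v ++ [ b ])

    tree : ∀ p {b} → F p b → IsTree (𝓔₁ X (p ++ v))
    tree p {b} f = dendric (p ++ v) (𝓛-init X (p ++ v) (subst (𝓛 X) (sym (++-assoc p v [ b ])) f))
      (≤-trans m≤v (length-++-≤ʳ v {p}))

    Edge⇔F : ∀ p {a b} → Edge X (p ++ v) a b ⇔ F (a ∷ p) b
    Edge⇔F p {a} {b} = mk⇔ (subst (λ t → 𝓛 X (a ∷ t)) (++-assoc p v [ b ]))
                           (subst (λ t → 𝓛 X (a ∷ t)) (sym (++-assoc p v [ b ])))

    letter-forest : ∀ p → Forest (λ a → F (a ∷ p))
    letter-forest p e =
      Forest-map (Edge⇔F p) (acyclic⇒forest X (p ++ v) _≟_ (proj₂ (proj₂ (tree p (𝓛-tail X e))))) e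

    letter-linked : ∀ p {b b′} → F p b → F p b′ → Linked (λ a → F (a ∷ p)) b b′
    letter-linked p {b} {b′} f f′ = Linked-map (to (Edge⇔F p)) (walk⇒linked X (p ++ v)
      (proj₁ (proj₂ (tree p f)) (inj₂ b) (inj₂ b′) (reassoc f) (reassoc f′)))
      where
      reassoc : ∀ {b} → F p b → R₁ X (p ++ v) b
      reassoc {b} = subst (𝓛 X) (sym (++-assoc p v [ b ]))

    open Substitution F (𝓛-tail X) φ

    forest : Forest (λ x b → 𝓛 X (φ x ++ v ++ [ b ]))
    forest = substitute-forest _≟_ _≟_ suffix-free letter-forest

    linked : ∀ {b b′} → 𝓛 X (v ++ [ b ]) → 𝓛 X (v ++ [ b′ ]) →
             Linked (λ x b → 𝓛 X (φ x ++ v ++ [ b ])) b b′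
    linked = substitute-linked letter-linked Nˡ (λ p f → completeˡ p (𝓛-prefix X p _ f))

  module TwoSidedExtension (v : List A) (m≤v : m ≤ length v) where

    -- The right-hand word is stored reversed, so that it too grows at the head; the vertices on the
    -- other side are now left codewords.
    F : List A → B → Set
    F q x = 𝓛 X (φ x ++ v ++ reverse q)

    m≤vq : ∀ q → m ≤ length (v ++ reverse q)
    m≤vq q = ≤-trans m≤v (length-++-≤ˡ v)

    snoc-eq : ∀ q a x → φ x ++ v ++ reverse (a ∷ q) ≡ φ x ++ (v ++ reverse q) ++ [ a ]
    snoc-eq q a x = cong (φ x ++_)
      (trans (cong (v ++_) (unfold-reverse a q)) (sym (++-assoc v (reverse q) [ a ])))

    snoc-⇔ : ∀ q {a x} → 𝓛 X (φ x ++ (v ++ reverse q) ++ [ a ]) ⇔ F (a ∷ q) x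
    snoc-⇔ q {a} {x} = mk⇔ (subst (𝓛 X) (sym (snoc-eq q a x))) (subst (𝓛 X) (snoc-eq q a x))

    F-tail : ∀ {a q x} → F (a ∷ q) x → F q x
    F-tail {a} {q} {x} f = 𝓛-init X (φ x ++ v ++ reverse q)
      (subst (𝓛 X) (sym (++-assoc (φ x) (v ++ reverse q) [ a ])) (from (snoc-⇔ q) f))

    letter-forest : ∀ q → Forest (λ a → F (a ∷ q))
    letter-forest q = Forest-map (snoc-⇔ q) (Forest-flip (LeftExtension.forest (v ++ reverse q) (m≤vq q)))

    F-extend : ∀ {q x} → F q x → ∃[ a ] 𝓛 X (φ x ++ (v ++ reverse q) ++ [ a ])
    F-extend {q} {x} f with 𝓛-extendʳ X _ f
    ... | a , g = a , subst (𝓛 X) (++-assoc (φ x) (v ++ reverse q) [ a ]) g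

    -- The first stage links right letters. Extending `x` and `x′` by letters `a` and `a′` supplies
    -- the end edges needed to turn this into a link between codewords.
    letter-linked : ∀ q {x x′} → F q x → F q x′ → Linked (λ a → F (a ∷ q)) x x′
    letter-linked q {x} {x′} f f′ with F-extend {q} f | F-extend {q} f′
    ... | a , g | a′ , g′ = Linked-map (to (snoc-⇔ q)) (Linked-flip g
      (LeftExtension.linked (v ++ reverse q) (m≤vq q) (𝓛-suffix X (φ x) g) (𝓛-suffix X (φ x′) g′)) g′)

    -- Reversal turns the prefix code property into the suffix code property that `Substitution`
    -- expects.
    reversed-code : ∀ {x y} s → reverse (φ x) ≡ s ++ reverse (φ y) → s ≡ [] × x ≡ y
    reversed-code {x} {y} s eq with prefix-free (reverse s) (reverse-injective (begin
        reverse (φ x)                          ≡⟨ eq ⟩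
        s ++ reverse (φ y)                     ≡⟨ cong (_++ reverse (φ y)) (reverse-involutive s) ⟨
        reverse (reverse s) ++ reverse (φ y)   ≡⟨ reverse-++ (φ y) (reverse s) ⟨
        reverse (φ y ++ reverse s)             ∎))
      where open ≡-Reasoning
    ... | rev-s≡[] , x≡y = reverse-injective rev-s≡[] , x≡y

    reversed-complete : ∀ q {x} → F q x → Nʳ ≤ length q → ∃[ y ] ∃[ s ] (s ++ reverse (φ y) ≡ q)
    reversed-complete q {x} f N≤
      with completeʳ (reverse q) (𝓛-suffix X v (𝓛-suffix X (φ x) f))
                     (≤-trans N≤ (≤-reflexive (sym (length-reverse q))))
    ... | y , s , eq = y , reverse s ,
      trans (sym (reverse-++ (φ y) s)) (trans (cong reverse eq) (reverse-involutive q))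

    _≟ᴮ_ : DecidableEquality B
    x ≟ᴮ y = map′ (λ eq → proj₂ (suffix-free [] eq)) (cong φ) (List-≡-dec _≟_ (φ x) (φ y))

    open Substitution F (λ {a} {q} → F-tail {a} {q}) (reverse ∘ φ)

    unreverse : ∀ {x y} → F (reverse (φ y)) x ⇔ 𝓛 X (φ x ++ v ++ φ y)
    unreverse {x} {y} = mk⇔ (subst (λ t → 𝓛 X (φ x ++ v ++ t)) (reverse-involutive (φ y)))
                            (subst (λ t → 𝓛 X (φ x ++ v ++ t)) (sym (reverse-involutive (φ y))))

    forest : Forest (λ x y → 𝓛 X (φ x ++ v ++ φ y))
    forest = Forest-map unreverse (Forest-flip (substitute-forest _≟_ _≟ᴮ_ reversed-code letter-forest))

    linked : ∀ {x x′} → 𝓛 X (φ x ++ v) → 𝓛 X (φ x′ ++ v) →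
             Linked (λ y x → 𝓛 X (φ x ++ v ++ φ y)) x x′
    linked f f′ = Linked-map (to unreverse)
      (substitute-linked letter-linked Nʳ reversed-complete (with-[] f) (with-[] f′))
      where
      with-[] : ∀ {x} → 𝓛 X (φ x ++ v) → F [] x
      with-[] {x} = subst (λ t → 𝓛 X (φ x ++ t)) (sym (++-identityʳ v))

  -- Transfer to the language of the decoding

  empty⇒singleton : ∀ {b} → φ b ≡ [] → ∀ (x y : B) → x ≡ y
  empty⇒singleton {b} eq x y = trans (≡b x) (sym (≡b y))
    where
    ≡b : ∀ z → z ≡ b
    -- The empty word is a prefix of every codeword.
    ≡b z = proj₂ (prefix-free (φ z) (cong (_++ φ z) (sym eq)))

  -- A nonempty codeword contributes at least one letter, which is why the threshold `m` carries
  -- over unchanged.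
  empty-or-long : ∀ w → (∃[ b ] φ b ≡ []) ⊎ length w ≤ length (ext φ w)
  empty-or-long [] = inj₂ z≤n
  empty-or-long (b ∷ w) with φ b in eq
  ... | []    = inj₁ (b , eq)
  ... | a ∷ u with empty-or-long w
  ...   | inj₁ e = inj₁ e
  ...   | inj₂ l = inj₂ (s≤s (≤-trans l (length-++-≤ʳ (ext φ w) {u})))

  module _ (Y : ShiftSpace B) (lang : ∀ w → 𝓛 Y w ⇔ 𝓛 X (ext φ w)) where

    Edge⇔ : ∀ w {b c} → 𝓛 X (φ b ++ ext φ w ++ φ c) ⇔ Edge Y w b c
    Edge⇔ w {b} {c} = mk⇔ (from (lang _) ∘′ subst (𝓛 X) (sym eq)) (subst (𝓛 X) eq ∘′ to (lang _))
      where
      eq : ext φ (b ∷ w ++ [ c ]) ≡ φ b ++ ext φ w ++ φ c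
      eq = cong (φ b ++_) (trans (concatMap-++ φ w [ c ]) (cong (ext φ w ++_) (++-identityʳ (φ c))))

    decoding-forest : ∀ w → m ≤ length w → Forest (Edge Y w)
    decoding-forest w m≤w with empty-or-long w
    -- With one letter there is at most one edge, whatever the length of `ext φ w`.
    ... | inj₁ (_ , eq) = singleton⇒forest (empty⇒singleton eq)
    ... | inj₂ l        = Forest-map (Edge⇔ w) (TwoSidedExtension.forest (ext φ w) (≤-trans m≤w l))

    decoding-linked : ∀ w → m ≤ length w → ∀ {b c} → L₁ Y w b → L₁ Y w c →
                      Linked (flip (Edge Y w)) b c
    decoding-linked w m≤w {b} {c} f g with empty-or-long w
    ... | inj₁ (_ , eq) = subst (Linked _ b) (empty⇒singleton eq b c) ε
    ... | inj₂ l        = Linked-map (to (Edge⇔ w))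
      (TwoSidedExtension.linked (ext φ w) (≤-trans m≤w l) (to (lang (b ∷ w)) f) (to (lang (c ∷ w)) g))

    decoding-dendric : EventuallyDendric Y m
    decoding-dendric w w∈ m≤w =
      (inj₁ (proj₁ left) , proj₂ left) ,
      linked⇒connected Y w (decoding-linked w m≤w) ,
      forest⇒acyclic Y w (decoding-forest w m≤w)
      where
      left : ∃[ b ] L₁ Y w b
      left = 𝓛-extendˡ Y w∈

-- The decoding theorem, with the code hypotheses restated through `φ`

theorem9p2 : {A B : Set} → Finite A → (X : ShiftSpace A) → (m : ℕ) →
    EventuallyDendric X m →
    (U : List A → Set) → FiniteSet U → (∀ u → U u → 𝓛 X u) →
    IsBifixCode U → TwoSidedComplete X U →
    (φ : B → List A) → IsBijectionOnto φ U →
    (Y : ShiftSpace B) → (∀ w → 𝓛 Y w ⇔ 𝓛 X (ext φ w)) →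
    EventuallyDendric Y m
theorem9p2 {A} {B} (_ , A↔Fin) X m dendric U _ _ (prefix-code , suffix-code)
           ((Nʳ , completeʳ) , (Nˡ , completeˡ)) φ (φ-inj , φ∈U , φ-onto) Y lang =
  decoding-dendric X m dendric (inj⇒≟ (↔⇒↣ A↔Fin)) φ prefix-free suffix-free
    Nʳ codeword-prefix Nˡ codeword-suffix Y lang
  where
  prefix-free : ∀ {x y} s → φ x ≡ φ y ++ s → s ≡ [] × x ≡ y
  prefix-free {x} {y} []      eq = refl , φ-inj (trans eq (++-identityʳ (φ y)))
  prefix-free {x} {y} (a ∷ s) eq = ⊥-elim (prefix-code _ _ (φ∈U y) (φ∈U x) (a ∷ s) (λ ()) (sym eq))

  suffix-free : ∀ {x y} s → φ x ≡ s ++ φ y → s ≡ [] × x ≡ y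
  suffix-free         []      eq = refl , φ-inj eq
  suffix-free {x} {y} (a ∷ s) eq = ⊥-elim (suffix-code _ _ (φ∈U y) (φ∈U x) (a ∷ s) (λ ()) (sym eq))

  codeword-prefix : ∀ w → 𝓛 X w → Nʳ ≤ length w → ∃[ x ] ∃[ s ] (φ x ++ s ≡ w)
  codeword-prefix w w∈ N≤ with completeʳ w w∈ N≤
  ... | u , u∈U , s , eq with φ-onto u u∈U
  ...   | x , refl = x , s , eq

  codeword-suffix : ∀ w → 𝓛 X w → Nˡ ≤ length w → ∃[ x ] ∃[ s ] (s ++ φ x ≡ w)
  codeword-suffix w w∈ N≤ with completeˡ w w∈ N≤
  ... | u , u∈U , s , eq with φ-onto u u∈U
  ...   | x , refl = x , s , eq
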